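{- Let $G=(V,E)$ be a hypergraph and let $OPT_k$ be the value of a minimum $k$-cut in $G$ for some integer $k\ge2$. Suppose $(U,\overline U)$ is a 2-partition of $V$ with $d(U)\le OPT_k$. Then there exists a subset $S\subseteq U$ with $|S|\le 2k-2$ such that $(U,\overline U)$ is the source maximal minimum $(S,\overline U)$-terminal cut in $G$.
   Context: A hypergraph $G=(V,E)$ has finite vertex set $V$ and finite multiset $E$ of unit-cost hyperedges (subsets of $V$). For $X\subseteq V$, $\overline X=V\setminus X$ and $d(X)$ is the number of hyperedges meeting both $X$ and $\overline X$. $OPT_k$ is the minimum, over all partitions of $V$ into $k$ non-empty parts, of the number of hyperedges meeting at least two parts. For disjoint $S,T\subseteq V$, a 2-partition $(X,\overline X)$ is an $(S,T)$-terminal cut if $S\subseteq X\subseteq V\setminus T$; it is minimum if $d(X)$ is minimum among such cuts; the source maximal minimum $(S,T)$-terminal cut is the unique minimum one whose source set $X$ is inclusion-wise maximal. -}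

module Defs where

open import Data.Fin using (Fin)
open import Data.Fin.Properties using (any?; _≟_)
open import Data.Fin.Subset using (Subset; _∈_; _⊆_; _∩_; ∁; Nonempty; Empty)
open import Data.Fin.Subset.Properties using (nonempty?)
open import Data.List using (List; length; filter)
open import Data.Nat using (ℕ; _≤_)
open import Data.Product using (_×_; ∃; ∃₂)
open import Relation.Binary.PropositionalEquality using (_≡_; _≢_)
open import Relation.Nullary using (Dec; ¬?; _×-dec_)

-- The list of hyperedges is used only through counting, so it plays the role
-- of a finite multiset.
record Hypergraph : Set where
  field
    ∣V∣ : ℕ
    E   : List (Subset ∣V∣)

open Hypergraph public

Meets : ∀ {n} → Subset n → Subset n → Set
Meets e X = Nonempty (e ∩ X)

Crosses : ∀ {n} → Subset n → Subset n → Set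
Crosses X e = Meets e X × Meets e (∁ X)

crosses? : ∀ {n} (X e : Subset n) → Dec (Crosses X e)
crosses? X e = nonempty? (e ∩ X) ×-dec nonempty? (e ∩ ∁ X)

d : (G : Hypergraph) → Subset (∣V∣ G) → ℕ
d G X = length (filter (crosses? X) (E G))

record IsPartition {n k : ℕ} (P : Fin k → Subset n) : Set where
  field
    nonempty : ∀ i → Nonempty (P i)
    disjoint : ∀ i j → i ≢ j → Empty (P i ∩ P j)
    covers   : ∀ v → ∃ λ i → v ∈ P i

MeetsTwoParts : ∀ {n k} → (Fin k → Subset n) → Subset n → Set
MeetsTwoParts P e = ∃₂ λ i j → i ≢ j × Meets e (P i) × Meets e (P j)

meetsTwoParts? : ∀ {n k} (P : Fin k → Subset n) (e : Subset n) →
                 Dec (MeetsTwoParts P e)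
meetsTwoParts? P e = any? λ i → any? λ j →
  ¬? (i ≟ j) ×-dec (nonempty? (e ∩ P i) ×-dec nonempty? (e ∩ P j))

cutValue : (G : Hypergraph) {k : ℕ} → (Fin k → Subset (∣V∣ G)) → ℕ
cutValue G P = length (filter (meetsTwoParts? P) (E G))

-- A relation rather than a function, since no k-partition exists when k > |V|.
record IsOPT (G : Hypergraph) (k opt : ℕ) : Set where
  field
    attained   : ∃ λ (P : Fin k → Subset (∣V∣ G)) →
                 IsPartition P × cutValue G P ≡ opt
    lowerBound : ∀ (P : Fin k → Subset (∣V∣ G)) →
                 IsPartition P → opt ≤ cutValue G P

-- (X , ∁ X) is a 2-partition.
Is2Partition : ∀ {n} → Subset n → Set
Is2Partition X = Nonempty X × Nonempty (∁ X)

-- The cuts below are represented by their source set X.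
record IsTerminalCut {n : ℕ} (S T X : Subset n) : Set where
  field
    is2Partition : Is2Partition X
    S⊆X          : S ⊆ X
    X⊆∁T         : X ⊆ ∁ T

record IsMinTerminalCut (G : Hypergraph) (S T X : Subset (∣V∣ G)) : Set where
  field
    isTerminalCut : IsTerminalCut S T X
    minimum       : ∀ Y → IsTerminalCut S T Y → d G X ≤ d G Y

record IsMaximalMinTerminalCut (G : Hypergraph) (S T X : Subset (∣V∣ G)) : Set where
  field
    isMinTerminalCut : IsMinTerminalCut G S T X
    maximal          : ∀ Y → IsMinTerminalCut G S T Y → X ⊆ Y → Y ≡ X

record IsSourceMaximalMinTerminalCut (G : Hypergraph) (S T X : Subset (∣V∣ G)) : Set where
  field
    isMaximal : IsMaximalMinTerminalCut G S T X
    unique    : ∀ Y → IsMaximalMinTerminalCut G S T Y → Y ≡ X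

{-# OPTIONS --safe #-}
module Submission where

-- Choose S of least size for which U is a minimum (S, ∁ U)-cut; source maximality is then
-- automatic, since every (S, ∁ U)-cut lies inside U.  If |S| exceeded p = 2k−2, pick distinct
-- u₁,…,uₚ ∈ S and let Xᵢ be a minimum (S − uᵢ, ∁ U)-cut.  Then d(Xᵢ) < d(U), and uᵢ is missed
-- by Xᵢ but by no other Xⱼ.  Let Z, Yᵢ, W be the sets of vertices missed by no X, by Xᵢ only,
-- and by at least two X's.  Uncrossing the Xᵢ one at a time shows that the number of hyperedges
-- meeting two of the classes Z, Y₁,…,Yₚ, W, plus the number of those meeting both Z and W or two
-- of the Yᵢ, is at most d(X₁) + d(X₂) < 2 OPTₖ.  But that quantity bounds the total cost of the
-- k-partitions {Y₁,…,Yₖ₋₁, rest} and {Yₖ,…,Y₂ₖ₋₂, rest}, which is at least 2 OPTₖ.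

open import Data.Bool using (Bool; true; false)
open import Data.Bool.Properties using () renaming (_≟_ to _≟ᵇ_)
open import Data.Empty using (⊥-elim)
open import Data.Fin using (Fin; zero; suc; inject≤; splitAt; _↑ˡ_; _↑ʳ_)
open import Data.Fin.Properties using (any?; _≟_; suc-injective; inject≤-injective; splitAt-↑ˡ; splitAt-↑ʳ)
open import Data.Fin.Subset using (Subset; _∈_; _∉_; _⊆_; _-_; ∁; ∣_∣; Nonempty; inside; outside)
open import Data.Fin.Subset.Properties using (_∈?_; _⊆?_; nonempty?; anySubset?; ⊆-antisym; ⊆-refl; x∈p∩q⁺; x∈p∩q⁻; x∈∁p⇒x∉p; x∉p⇒x∈∁p; x∈p∧x≢y⇒x∈p-y; x∈p⇒∣p-x∣<∣p∣; p─q⊆p)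
open import Data.List using (List; []; _∷_; length; filter; map)
open import Data.Nat.ListAction using (sum)
open import Data.Nat using (ℕ; zero; suc; _≤_; _<_; _+_; _*_; _∸_; z≤n; s≤s; _≤?_; _<?_)
open import Data.Nat.Induction using (<-wellFounded)
open import Data.Nat.Properties using (≤-antisym; +-monoˡ-≤; ≤-refl; ≤-reflexive; ≤-trans; <-≤-trans; ≤-<-trans; <⇒≤; <-irrefl; ≰⇒>; ≮⇒≥; <⇒≱; +-mono-≤; +-mono-<; +-monoʳ-≤; +-cancelʳ-≤; m≤m+n; m≤n+m; +-suc; +-identityʳ; module ≤-Reasoning)
open import Data.Nat.Solver using (module +-*-Solver)
open import Data.Product using (_×_; _,_; ∃; ∃₂; proj₁; proj₂)
open import Data.Sum using (_⊎_; inj₁; inj₂; [_,_]′)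
open import Data.Vec using (_∷_; lookup; tabulate; here; there)
open import Data.Vec.Properties using (lookup∘tabulate; []=⇒lookup; lookup⇒[]=)
open import Function using (_∘_)
open import Induction.WellFounded using (Acc; acc)
open import Relation.Binary.PropositionalEquality using (_≡_; _≢_; refl; sym; trans; cong; cong₂; subst₂)
open import Relation.Nullary using (Dec; yes; no; ¬_; ¬?; _×-dec_; does)
open import Relation.Nullary.Decidable using (map′; decidable-stable; dec-true; dec-false)
open import Relation.Unary using (Decidable)
open import Defs

-- Indicators and sums over the hyperedges

χ : {P : Set} → Dec P → ℕ
χ (yes _) = 1
χ (no _)  = 0

χ-pos : {P : Set} (P? : Dec P) → P → 1 ≤ χ P?
χ-pos (yes _) _ = ≤-refl
χ-pos (no ¬p) p = ⊥-elim (¬p p)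

χ-mono : {P Q : Set} (P? : Dec P) (Q? : Dec Q) → (P → Q) → χ P? ≤ χ Q?
χ-mono (yes p) Q? f = χ-pos Q? (f p)
χ-mono (no _)  _  _ = z≤n

∑ : {A : Set} → List A → (A → ℕ) → ℕ
∑ xs f = sum (map f xs)

∑-mono : {A : Set} (xs : List A) {f g : A → ℕ} → (∀ x → f x ≤ g x) → ∑ xs f ≤ ∑ xs g
∑-mono []       f≤g = z≤n
∑-mono (x ∷ xs) f≤g = +-mono-≤ (f≤g x) (∑-mono xs f≤g)

∑-+ : {A : Set} (xs : List A) (f g : A → ℕ) → ∑ xs (λ x → f x + g x) ≡ ∑ xs f + ∑ xs g
∑-+ []       f g = refl
∑-+ (x ∷ xs) f g rewrite ∑-+ xs f g =
  solve 4 (λ a b c e → (a :+ b) :+ (c :+ e) := (a :+ c) :+ (b :+ e)) refl (f x) (g x) (∑ xs f) (∑ xs g)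
  where open +-*-Solver

∑-χ : {A : Set} {P : A → Set} (P? : Decidable P) (xs : List A) →
      length (filter P? xs) ≡ ∑ xs (χ ∘ P?)
∑-χ P? []       = refl
∑-χ P? (x ∷ xs) with P? x
... | yes _ = cong suc (∑-χ P? xs)
... | no _  = ∑-χ P? xs

-- Hyperedges that meet two classes of vertices

Spread : {Q : Set} → (Q → Set) → (Q → Q → Set) → Set
Spread O R = ∃₂ λ q r → O q × O r × R q r

-- Passing from a hyperedge to the set of types (label, bit) of its vertices makes the uncrossing a
-- finite case analysis by matching on types.
Image : ∀ {n} {Q : Set} → (Fin n → Q) → Subset n → Q → Set
Image f e q = ∃ λ v → v ∈ e × f v ≡ q

Differ : {Q L : Set} → (Q → L) → Q → Q → Set
Differ g q r = g q ≢ g r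

SpreadOn : ∀ {n} → Subset n → (Fin n → Fin n → Set) → Set
SpreadOn e = Spread (_∈ e)

spreadOn? : ∀ {n} (e : Subset n) {R : Fin n → Fin n → Set} → (∀ u v → Dec (R u v)) → Dec (SpreadOn e R)
spreadOn? e R? = any? λ u → any? λ v → u ∈? e ×-dec (v ∈? e ×-dec R? u v)

module _ {n} {Q : Set} (f : Fin n → Q) (e : Subset n) {R : Q → Q → Set} where

  spreadOn⇒spread : SpreadOn e (λ u v → R (f u) (f v)) → Spread (Image f e) R
  spreadOn⇒spread (u , v , u∈e , v∈e , r) = f u , f v , (u , u∈e , refl) , (v , v∈e , refl) , r

  spread⇒spreadOn : Spread (Image f e) R → SpreadOn e (λ u v → R (f u) (f v))
  spread⇒spreadOn (_ , _ , (u , u∈e , refl) , (v , v∈e , refl) , r) = u , v , u∈e , v∈e , r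

Varies : ∀ {n} {L : Set} → (Fin n → L) → Subset n → Set
Varies f e = SpreadOn e (Differ f)

varies? : ∀ {n} {L : Set} → (∀ (a b : L) → Dec (a ≡ b)) → (f : Fin n → L) (e : Subset n) → Dec (Varies f e)
varies? _≟_ f e = spreadOn? e λ u v → ¬? (f u ≟ f v)

spread-Bool : {Q : Set} {O : Q → Set} (f : Q → Bool) → Spread O (Differ f) →
              (∃ λ q → O q × f q ≡ false) × (∃ λ q → O q × f q ≡ true)
spread-Bool f (q , r , oq , or , q≢r) with f q in eq₁ | f r in eq₂
... | false | false = ⊥-elim (q≢r refl)
... | false | true  = (q , oq , eq₁) , (r , or , eq₂)
... | true  | false = (r , or , eq₂) , (q , oq , eq₁)
... | true  | true  = ⊥-elim (q≢r refl)

∈⇒lookup : ∀ {n v} {X : Subset n} → v ∈ X → lookup X v ≡ true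
∈⇒lookup = []=⇒lookup

lookup⇒∈ : ∀ {n v} {X : Subset n} → lookup X v ≡ true → v ∈ X
lookup⇒∈ {v = v} {X} = lookup⇒[]= v X

∉⇒lookup : ∀ {n v} {X : Subset n} → v ∉ X → lookup X v ≡ false
∉⇒lookup {v = v} {X} v∉X with lookup X v in eq
... | false = refl
... | true  = ⊥-elim (v∉X (lookup⇒∈ eq))

lookup⇒∉ : ∀ {n v} {X : Subset n} → lookup X v ≡ false → v ∉ X
lookup⇒∉ eq v∈X with trans (sym eq) (∈⇒lookup v∈X)
... | ()

crosses⇒varies : ∀ {n} (X e : Subset n) → Crosses X e → Varies (lookup X) e
crosses⇒varies X e ((u , u∈) , (v , v∈)) with x∈p∩q⁻ e X u∈ | x∈p∩q⁻ e (∁ X) v∈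
... | u∈e , u∈X | v∈e , v∈∁X = u , v , u∈e , v∈e ,
  λ eq → x∈∁p⇒x∉p v∈∁X (lookup⇒∈ (trans (sym eq) (∈⇒lookup u∈X)))

varies⇒crosses : ∀ {n} (X e : Subset n) → Varies (lookup X) e → Crosses X e
varies⇒crosses X e s with spread-Bool (lookup X) s
... | (u , u∈e , u∉X) , (v , v∈e , v∈X) =
  (v , x∈p∩q⁺ (v∈e , lookup⇒∈ v∈X)) , (u , x∈p∩q⁺ (u∈e , x∉p⇒x∈∁p (lookup⇒∉ u∉X)))

-- For a family X, the label of a vertex records the indices i with v ∉ X i, up to "at least two".
data Label (p : ℕ) : Set where
  none : Label p
  one  : Fin p → Label p
  many : Label p

one-injective : ∀ {p} {i j : Fin p} → one i ≡ one j → i ≡ j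
one-injective refl = refl

_≟ˡ_ : ∀ {p} (a b : Label p) → Dec (a ≡ b)
none  ≟ˡ none  = yes refl
none  ≟ˡ one _ = no λ ()
none  ≟ˡ many  = no λ ()
one _ ≟ˡ none  = no λ ()
one i ≟ˡ one j = map′ (cong one) one-injective (i ≟ j)
one _ ≟ˡ many  = no λ ()
many  ≟ˡ none  = no λ ()
many  ≟ˡ one _ = no λ ()
many  ≟ˡ many  = yes refl

push : ∀ {p} → Bool → Label p → Label (suc p)
push _     many    = many
push true  none    = none
push true  (one i) = one (suc i)
push false none    = one zero
push false (one _) = many

-- The recursion peels off `X zero`, so that this set can be uncrossed against the labels of the
-- remaining ones.
label : ∀ {n p} → (Fin p → Subset n) → Fin n → Label p
label {p = zero}  X v = none
label {p = suc p} X v = push (lookup (X zero) v) (label (X ∘ suc) v)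

-- One orientation of the pair Z, W is enough, because `Spread` ranges over ordered pairs.
data Heavy {p} : Label p → Label p → Set where
  none-many : Heavy none many
  one-one   : ∀ {i j} → i ≢ j → Heavy (one i) (one j)

heavy? : ∀ {p} (a b : Label p) → Dec (Heavy a b)
heavy? none    none    = no λ ()
heavy? none    (one _) = no λ ()
heavy? none    many    = yes none-many
heavy? (one _) none    = no λ ()
heavy? (one i) (one j) = map′ one-one (λ { (one-one i≢j) → i≢j }) (¬? (i ≟ j))
heavy? (one _) many    = no λ ()
heavy? many    _       = no λ ()

heavy⇒≢ : ∀ {p} {a b : Label p} → Heavy a b → a ≢ b
heavy⇒≢ none-many     ()
heavy⇒≢ (one-one i≢j) refl = i≢j refl

weight : ∀ {n p} → (Fin n → Label p) → Subset n → ℕ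
weight ℓ e = χ (varies? _≟ˡ_ ℓ e) + χ (spreadOn? e λ u v → heavy? (ℓ u) (ℓ v))

-- Indicator of X ∪ {v : ℓ v ≢ many}, the set that is uncrossed against X.
keep : ∀ {p} → Bool → Label p → Bool
keep b many    = b
keep _ none    = true
keep _ (one _) = true

-- Uncrossing inequality for a single hyperedge

-- Intended reading: `x`, `y` say that the new labels vary or are heavy, `a`, `b` the same for the
-- old labels; `w`, `c` say that the kept set and the added set are crossed. As `b` implies `a`, the
-- right side reaches 1, 2, 3 exactly under `a ⊎ c`, `b ⊎ a × c`, `b × c`.
χ-uncross : {x y w a b c : Set}
  (x? : Dec x) (y? : Dec y) (w? : Dec w) (a? : Dec a) (b? : Dec b) (c? : Dec c) →
  (y → x) → (b → a) →
  (x → a ⊎ c) → (w → a ⊎ c) →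
  (y → b ⊎ a × c) → (x → w → b ⊎ a × c) →
  (y → w → b × c) →
  χ x? + χ y? + χ w? ≤ χ a? + χ b? + χ c?
χ-uncross {a = a} {b} {c} x? y? w? a? b? c? y⇒x b⇒a x⇒₁ w⇒₁ y⇒₂ xw⇒₂ yw⇒₃ = go x? y? w?
  where
  rhs = χ a? + χ b? + χ c?

  ≥1 : a ⊎ c → 1 ≤ rhs
  ≥1 (inj₁ pa) = ≤-trans (χ-pos a? pa) (≤-trans (m≤m+n _ (χ b?)) (m≤m+n _ (χ c?)))
  ≥1 (inj₂ pc) = ≤-trans (χ-pos c? pc) (m≤n+m _ (χ a? + χ b?))

  ≥2 : b ⊎ a × c → 2 ≤ rhs
  ≥2 (inj₁ pb)        = ≤-trans (+-mono-≤ (χ-pos a? (b⇒a pb)) (χ-pos b? pb)) (m≤m+n _ (χ c?))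
  ≥2 (inj₂ (pa , pc)) = +-mono-≤ (≤-trans (χ-pos a? pa) (m≤m+n _ (χ b?))) (χ-pos c? pc)

  ≥3 : b × c → 3 ≤ rhs
  ≥3 (pb , pc) = +-mono-≤ (+-mono-≤ (χ-pos a? (b⇒a pb)) (χ-pos b? pb)) (χ-pos c? pc)

  go : ∀ x? y? w? → χ x? + χ y? + χ w? ≤ rhs
  go (yes _)  (yes py) (yes pw) = ≥3 (yw⇒₃ py pw)
  go (yes _)  (yes py) (no _)   = ≥2 (y⇒₂ py)
  go (yes px) (no _)   (yes pw) = ≥2 (xw⇒₂ px pw)
  go (yes px) (no _)   (no _)   = ≥1 (x⇒₁ px)
  go (no ¬x)  (yes py) _        = ⊥-elim (¬x (y⇒x py))
  go (no _)   (no _)   (yes pw) = ≥1 (w⇒₁ pw)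
  go (no _)   (no _)   (no _)   = z≤n

module _ {p : ℕ} (O : Label p × Bool → Set) where

  private
    lab : Label p × Bool → Label p
    lab = proj₁

    lab⁺ : Label p × Bool → Label (suc p)
    lab⁺ (l , b) = push b l

    kept : Label p × Bool → Bool
    kept (l , b) = keep b l

    HeavyAt : ∀ {q} → (Label p × Bool → Label q) → Label p × Bool → Label p × Bool → Set
    HeavyAt f r s = Heavy (f r) (f s)

    A B C X Y K : Set
    A = Spread O (Differ lab)
    B = Spread O (HeavyAt lab)
    C = Spread O (Differ proj₂)
    X = Spread O (Differ lab⁺)
    Y = Spread O (HeavyAt lab⁺)
    K = Spread O (Differ kept)

    -- `keep` is false at the type `(many , false)` only.
    unkept : K → O (many , false) × (∃ λ q → O q × kept q ≡ true)
    unkept s with spread-Bool kept s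
    ... | ((many , false) , o , refl) , q = o , q
    ... | ((none , _)     , _ , ())   , _
    ... | ((one _ , _)    , _ , ())   , _
    ... | ((many , true)  , _ , ())   , _

  differ⁺ : X → A ⊎ C
  differ⁺ ((l , b) , (m , c) , o , o′ , l≢m) with l ≟ˡ m
  ... | no ¬eq   = inj₁ (_ , _ , o , o′ , ¬eq)
  ... | yes refl = inj₂ (_ , _ , o , o′ , λ { refl → l≢m refl })

  differ-kept : K → A ⊎ C
  differ-kept s with unkept s
  ... | o , (none  , b)    , o′ , _ = inj₁ (_ , _ , o , o′ , λ ())
  ... | o , (one _ , b)    , o′ , _ = inj₁ (_ , _ , o , o′ , λ ())
  ... | o , (many  , true) , o′ , _ = inj₂ (_ , _ , o , o′ , λ ())

  -- A new `none` comes from `(none , true)`, a new `many` from an old one or from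
  -- `(one _ , false)`, and the fresh class `one zero` from `(none , false)`. So a newly heavy pair
  -- was heavy before or differs in both old label and bit.
  heavy⁺ : Y → B ⊎ A × C
  heavy⁺ ((none  , true)  , (many  , _)     , o , o′ , none-many) = inj₁ (_ , _ , o , o′ , none-many)
  heavy⁺ ((none  , true)  , (one _ , false) , o , o′ , none-many) =
    inj₂ ((_ , _ , o , o′ , λ ()) , (_ , _ , o , o′ , λ ()))
  heavy⁺ ((none  , true)  , (none  , true)  , o , o′ , ())
  heavy⁺ ((none  , true)  , (none  , false) , o , o′ , ())
  heavy⁺ ((one _ , true)  , (one _ , true)  , o , o′ , one-one i≢j) =
    inj₁ (_ , _ , o , o′ , one-one (i≢j ∘ cong suc))
  heavy⁺ ((one _ , true)  , (none  , false) , o , o′ , one-one _) =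
    inj₂ ((_ , _ , o , o′ , λ ()) , (_ , _ , o , o′ , λ ()))
  heavy⁺ ((none  , false) , (one _ , true)  , o , o′ , one-one _) =
    inj₂ ((_ , _ , o , o′ , λ ()) , (_ , _ , o , o′ , λ ()))
  heavy⁺ ((none  , false) , (none  , false) , o , o′ , one-one i≢j) = ⊥-elim (i≢j refl)

  private
    not-many⁺ : X → ∃ λ q → O q × lab⁺ q ≢ many
    not-many⁺ (q , r , o , o′ , q≢r) with lab⁺ q ≟ˡ many
    ... | no ¬eq = q , o , ¬eq
    ... | yes eq = r , o′ , λ eq′ → q≢r (trans eq (sym eq′))

  -- Besides `(many , false)` there is a type whose new label is not `many`. If its old label is
  -- `none`, the two are heavy; otherwise it is `(one _ , true)` and differs in label and bit.
  differ⁺-kept : X → K → B ⊎ A × C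
  differ⁺-kept x s with unkept s | not-many⁺ x
  ... | _                            | (many  , _)     , _ , ¬many = ⊥-elim (¬many refl)
  ... | _                            | (one _ , false) , _ , ¬many = ⊥-elim (¬many refl)
  ... | o , _                        | (none  , b)     , o′ , _ = inj₁ (_ , _ , o′ , o , none-many)
  ... | o , _                        | (one _ , true)  , o′ , _ =
    inj₂ ((_ , _ , o , o′ , λ ()) , (_ , _ , o , o′ , λ ()))

  -- Every newly heavy pair contains a type with bit `true`, which differs in bit from
  -- `(many , false)`. A type with old label `none` in the pair is heavy against `(many , false)`;
  -- without one, the pair itself was heavy before.
  heavy⁺-kept : Y → K → B × C
  heavy⁺-kept y s with unkept s
  heavy⁺-kept ((none  , true)  , (_     , _)     , o , o′ , _)         s | om , _ =
    (_ , _ , o , om , none-many) , (_ , _ , o , om , λ ())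
  heavy⁺-kept ((one _ , true)  , (one _ , true)  , o , o′ , one-one i≢j) s | om , _ =
    (_ , _ , o , o′ , one-one (i≢j ∘ cong suc)) , (_ , _ , o , om , λ ())
  heavy⁺-kept ((one _ , true)  , (none  , false) , o , o′ , one-one _) s | om , _ =
    (_ , _ , o′ , om , none-many) , (_ , _ , o , om , λ ())
  heavy⁺-kept ((none  , false) , (one _ , true)  , o , o′ , one-one _) s | om , _ =
    (_ , _ , o , om , none-many) , (_ , _ , o′ , om , λ ())
  heavy⁺-kept ((none  , false) , (none  , false) , o , o′ , one-one i≢j) s | om , _ =
    ⊥-elim (i≢j refl)

weight-push : ∀ {n p} (ℓ : Fin n → Label p) (b : Fin n → Bool) (e : Subset n) →
  weight (λ v → push (b v) (ℓ v)) e + χ (varies? _≟ᵇ_ (λ v → keep (b v) (ℓ v)) e)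
  ≤ weight ℓ e + χ (varies? _≟ᵇ_ b e)
weight-push ℓ b e = χ-uncross
  (varies? _≟ˡ_ (λ v → push (b v) (ℓ v)) e)
  (spreadOn? e λ u v → heavy? (push (b u) (ℓ u)) (push (b v) (ℓ v)))
  (varies? _≟ᵇ_ (λ v → keep (b v) (ℓ v)) e)
  (varies? _≟ˡ_ ℓ e)
  (spreadOn? e λ u v → heavy? (ℓ u) (ℓ v))
  (varies? _≟ᵇ_ b e)
  (λ (u , v , u∈e , v∈e , h) → u , v , u∈e , v∈e , heavy⇒≢ h)
  (λ (u , v , u∈e , v∈e , h) → u , v , u∈e , v∈e , heavy⇒≢ h)
  (λ x → to₁ (differ⁺ O (from x)))
  (λ k → to₁ (differ-kept O (from k)))
  (λ y → to₂ (heavy⁺ O (from y)))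
  (λ x k → to₂ (differ⁺-kept O (from x) (from k)))
  (λ y k → let h , c = heavy⁺-kept O (from y) (from k) in to h , to c)
  where
  f = λ v → ℓ v , b v
  O = Image f e
  from = λ {R} → spreadOn⇒spread f e {R}
  to = λ {R} → spread⇒spreadOn f e {R}

  to₁ : ∀ {R R′} → Spread O R ⊎ Spread O R′ →
        SpreadOn e (λ u v → R (f u) (f v)) ⊎ SpreadOn e (λ u v → R′ (f u) (f v))
  to₁ (inj₁ s) = inj₁ (to s)
  to₁ (inj₂ s) = inj₂ (to s)

  to₂ : ∀ {R R′ R″} → Spread O R ⊎ Spread O R′ × Spread O R″ →
        SpreadOn e (λ u v → R (f u) (f v)) ⊎
        SpreadOn e (λ u v → R′ (f u) (f v)) × SpreadOn e (λ u v → R″ (f u) (f v))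
  to₂ (inj₁ s)       = inj₁ (to s)
  to₂ (inj₂ (s , t)) = inj₂ (to s , to t)

label-none : ∀ {n p} (X : Fin p → Subset n) {v} → (∀ i → v ∈ X i) → label X v ≡ none
label-none {p = zero}  X v∈ = refl
label-none {p = suc p} X v∈ = cong₂ push (∈⇒lookup (v∈ zero)) (label-none (X ∘ suc) (v∈ ∘ suc))

label-one : ∀ {n p} (X : Fin p → Subset n) {v} i → v ∉ X i → (∀ j → j ≢ i → v ∈ X j) → label X v ≡ one i
label-one X zero    v∉ v∈ =
  cong₂ push (∉⇒lookup v∉) (label-none (X ∘ suc) λ j → v∈ (suc j) λ ())
label-one X (suc i) v∉ v∈ =
  cong₂ push (∈⇒lookup (v∈ zero λ ())) (label-one (X ∘ suc) i v∉ λ j j≢i → v∈ (suc j) (j≢i ∘ suc-injective))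

label-many : ∀ {n p} → 2 ≤ p → (X : Fin p → Subset n) → ∀ {v} → (∀ i → v ∉ X i) → label X v ≡ many
label-many {p = 2} _ X v∉ =
  cong₂ push (∉⇒lookup (v∉ zero)) (cong₂ push (∉⇒lookup (v∉ (suc zero))) refl)
label-many {p = 1} (s≤s ())
label-many {p = suc (suc (suc _))} _ X v∉ = cong (push _) (label-many (s≤s (s≤s z≤n)) (X ∘ suc) (v∉ ∘ suc))

-- Uncrossing

module _ (G : Hypergraph) where

  private
    n = ∣V∣ G
    ∑ᴱ = ∑ (E G)

  δ : (Fin n → Bool) → ℕ
  δ f = ∑ᴱ (χ ∘ varies? _≟ᵇ_ f)

  total : ∀ {p} → (Fin n → Label p) → ℕ
  total ℓ = ∑ᴱ (weight ℓ)

  -- Allowing any pointwise equal `f` covers sets built by `tabulate`, such as `extend X`.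
  d≡δ : ∀ X f → (∀ v → lookup X v ≡ f v) → d G X ≡ δ f
  d≡δ X f X≗f = trans (∑-χ (crosses? X) (E G)) (≤-antisym
    (∑-mono (E G) λ e → χ-mono _ (varies? _≟ᵇ_ f e) (relabel ∘ crosses⇒varies X e))
    (∑-mono (E G) λ e → χ-mono (varies? _≟ᵇ_ f e) _ (varies⇒crosses X e ∘ unlabel)))
    where
    relabel : ∀ {e} → Varies (lookup X) e → Varies f e
    relabel (u , v , u∈ , v∈ , u≢v) = u , v , u∈ , v∈ , subst₂ _≢_ (X≗f u) (X≗f v) u≢v

    unlabel : ∀ {e} → Varies f e → Varies (lookup X) e
    unlabel (u , v , u∈ , v∈ , u≢v) = u , v , u∈ , v∈ , subst₂ _≢_ (sym (X≗f u)) (sym (X≗f v)) u≢v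

  extend : ∀ {p} → (Fin (suc p) → Subset n) → Subset n
  extend X = tabulate λ v → keep (lookup (X zero) v) (label (X ∘ suc) v)

  total-step : ∀ {p} (X : Fin (suc p) → Subset n) →
    total (label X) + d G (extend X) ≤ total (label (X ∘ suc)) + d G (X zero)
  total-step X = begin
    total (label X) + d G (extend X)
      ≡⟨ cong (total (label X) +_) (d≡δ (extend X) _ (lookup∘tabulate _)) ⟩
    total (label X) + δ (λ v → keep (lookup (X zero) v) (label (X ∘ suc) v))
      ≡⟨ ∑-+ (E G) _ _ ⟨
    ∑ᴱ _
      ≤⟨ ∑-mono (E G) (weight-push (label (X ∘ suc)) (lookup (X zero))) ⟩
    ∑ᴱ _
      ≡⟨ ∑-+ (E G) _ _ ⟩
    total (label (X ∘ suc)) + δ (lookup (X zero))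
      ≡⟨ cong (total (label (X ∘ suc)) +_) (d≡δ (X zero) _ (λ _ → refl)) ⟨
    total (label (X ∘ suc)) + d G (X zero) ∎
    where open ≤-Reasoning

  total-none : total {0} (λ _ → none) ≡ 0
  total-none = go (E G)
    where
    go : ∀ es → ∑ es (weight {n} {0} (λ _ → none)) ≡ 0
    go []       = refl
    go (e ∷ es) with varies? {L = Label 0} _≟ˡ_ (λ _ → none) e | spreadOn? {n} e (λ _ _ → heavy? {0} none none)
    ... | yes (_ , _ , _ , _ , ≢) | _ = ⊥-elim (≢ refl)
    ... | no _ | yes (_ , _ , _ , _ , ())
    ... | no _ | no _ = go es

  -- Induction on p. For p ≥ 3, `extend X` lies between `X zero` and `U`, so minimality gives
  -- d(`X zero`) ≤ d(`extend X`), and by `total-step` dropping `X zero` does not lower the total.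
  total-bound : ∀ {p} → 2 ≤ p → (U : Subset n) (X : Fin p → Subset n) → (∀ i → X i ⊆ U) →
    (∀ i Y → X i ⊆ Y → Y ⊆ U → d G (X i) ≤ d G Y) →
    ∀ {o} → (∀ i → d G (X i) < o) → total (label X) < o + o
  total-bound {1} (s≤s ())
  -- With two sets left, both extension terms are simply discarded, leaving the sum of the two cut
  -- values.
  total-bound {2} _ U X X⊆U min {o} d<o = begin-strict
    total (label X)
      ≤⟨ ≤-trans (m≤m+n _ _) (total-step X) ⟩
    total (label (X ∘ suc)) + d G (X zero)
      ≤⟨ +-monoˡ-≤ _ (≤-trans (m≤m+n _ _) (total-step (X ∘ suc))) ⟩
    total {0} (λ _ → none) + d G (X (suc zero)) + d G (X zero)
      ≡⟨ cong (λ t → t + d G (X (suc zero)) + d G (X zero)) total-none ⟩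
    d G (X (suc zero)) + d G (X zero)
      <⟨ +-mono-< (d<o (suc zero)) (d<o zero) ⟩
    o + o ∎
    where open ≤-Reasoning
  total-bound {suc (suc (suc _))} _ U X X⊆U min d<o =
    ≤-<-trans total≤ (total-bound (s≤s (s≤s z≤n)) U (X ∘ suc) (X⊆U ∘ suc) (min ∘ suc) (d<o ∘ suc))
    where
    X₀⊆ : X zero ⊆ extend X
    X₀⊆ {v} v∈ = lookup⇒∈ (trans (lookup∘tabulate _ v)
      (trans (cong (λ b → keep b (label (X ∘ suc) v)) (∈⇒lookup v∈)) (keep-true (label (X ∘ suc) v))))
      where
      keep-true : ∀ {p} (l : Label p) → keep true l ≡ true
      keep-true none    = refl
      keep-true (one _) = refl
      keep-true many    = refl

    -- A vertex outside `U` is missed by all of the at least two remaining sets, so its label is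
    -- `many` and `keep` returns its bit in `X zero`, which is false.
    ⊆U : extend X ⊆ U
    ⊆U {v} v∈ = decidable-stable (v ∈? U) λ v∉U → lookup⇒∉ (trans (lookup∘tabulate _ v)
      (cong₂ keep (∉⇒lookup (v∉U ∘ X⊆U zero)) (label-many (s≤s (s≤s z≤n)) (X ∘ suc) λ i → v∉U ∘ X⊆U (suc i)))) v∈

    total≤ : total (label X) ≤ total (label (X ∘ suc))
    total≤ = +-cancelʳ-≤ (d G (X zero)) _ _
      (≤-trans (+-monoʳ-≤ (total (label X)) (min zero (extend X) X₀⊆ ⊆U)) (total-step X))

-- The two k-partitions

parts : ∀ {n k} → (Fin n → Fin k) → Fin k → Subset n
parts f i = tabulate λ v → does (f v ≟ i)

module _ {n k} (f : Fin n → Fin k) where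

  ∈parts⁺ : ∀ {v i} → f v ≡ i → v ∈ parts f i
  ∈parts⁺ {v} {i} eq = lookup⇒∈ (trans (lookup∘tabulate _ v) (dec-true (f v ≟ i) eq))

  ∈parts⁻ : ∀ {v i} → v ∈ parts f i → f v ≡ i
  ∈parts⁻ {v} {i} v∈ = decidable-stable (f v ≟ i) λ neq →
    lookup⇒∉ (trans (lookup∘tabulate _ v) (dec-false (f v ≟ i) neq)) v∈

  parts-isPartition : (∀ i → ∃ λ v → f v ≡ i) → IsPartition (parts f)
  parts-isPartition surj = record
    { nonempty = λ i → let v , eq = surj i in v , ∈parts⁺ eq
    ; disjoint = λ i j i≢j (v , v∈) → let v∈i , v∈j = x∈p∩q⁻ _ _ v∈ in
                   i≢j (trans (sym (∈parts⁻ v∈i)) (∈parts⁻ v∈j))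
    ; covers   = λ v → f v , ∈parts⁺ refl
    }

  meetsTwoParts⇒varies : ∀ e → MeetsTwoParts (parts f) e → Varies f e
  meetsTwoParts⇒varies e (i , j , i≢j , (u , u∈) , (v , v∈)) with x∈p∩q⁻ e _ u∈ | x∈p∩q⁻ e _ v∈
  ... | u∈e , u∈i | v∈e , v∈j = u , v , u∈e , v∈e ,
    λ eq → i≢j (trans (sym (∈parts⁻ u∈i)) (trans eq (∈parts⁻ v∈j)))

cutValue-parts : ∀ G {k} (f : Fin (∣V∣ G) → Fin k) → cutValue G (parts f) ≤ ∑ (E G) (χ ∘ varies? _≟_ f)
cutValue-parts G f = ≤-trans (≤-reflexive (∑-χ (meetsTwoParts? (parts f)) (E G)))
  (∑-mono (E G) λ e → χ-mono _ _ (meetsTwoParts⇒varies f e))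

-- Part `zero` is the rest. With k = m + 1 and r = m, `splitAt` halves the 2k - 2 indices between
-- the two partitions.
groupˡ : ∀ m {r} → Label (m + r) → Fin (suc m)
groupˡ m (one i) = [ suc , (λ _ → zero) ]′ (splitAt m i)
groupˡ m _       = zero

groupʳ : ∀ m {r} → Label (m + r) → Fin (suc r)
groupʳ m (one i) = [ (λ _ → zero) , suc ]′ (splitAt m i)
groupʳ m _       = zero

groups-heavy : ∀ m {r} (a b : Label (m + r)) → groupˡ m a ≢ zero → groupʳ m b ≢ zero → Heavy a b
groups-heavy m none    _       a≢ b≢ = ⊥-elim (a≢ refl)
groups-heavy m many    _       a≢ b≢ = ⊥-elim (a≢ refl)
groups-heavy m (one _) none    a≢ b≢ = ⊥-elim (b≢ refl)
groups-heavy m (one _) many    a≢ b≢ = ⊥-elim (b≢ refl)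
groups-heavy m (one i) (one j) a≢ b≢ = one-one λ { refl → not-both (splitAt m i) a≢ b≢ }
  where
  not-both : ∀ {r} (s : Fin m ⊎ Fin r) → [ suc , (λ _ → zero) ]′ s ≢ zero →
             ¬ ([_,_]′ {C = Fin (suc r)} (λ _ → zero) suc s ≢ zero)
  not-both (inj₁ _) _  b≢ = b≢ refl
  not-both (inj₂ _) a≢ _  = a≢ refl

varies-nonzero : ∀ {n k} (f : Fin n → Fin (suc k)) {e} → Varies f e → ∃ λ v → v ∈ e × f v ≢ zero
varies-nonzero f (u , v , u∈e , v∈e , u≢v) with f u ≟ zero
... | no u≢0  = u , u∈e , u≢0
... | yes u≡0 = v , v∈e , λ v≡0 → u≢v (trans u≡0 (sym v≡0))

-- A hyperedge cut by a partition meets a part other than the rest. If both partitions cut it, it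
-- therefore meets some Yᵢ and Yⱼ from different halves, and the heavy term pays for the second cut.
groups-weight : ∀ {n} m {r} (ℓ : Fin n → Label (m + r)) (e : Subset n) →
  χ (varies? _≟_ (groupˡ m ∘ ℓ) e) + χ (varies? _≟_ (groupʳ m ∘ ℓ) e) ≤ weight ℓ e
groups-weight m ℓ e
  with varies? _≟_ (groupˡ m ∘ ℓ) e | varies? _≟_ (groupʳ m ∘ ℓ) e
... | no _  | no _  = z≤n
... | yes x | no _  = ≤-trans (χ-pos (varies? _≟ˡ_ ℓ e) (lift x)) (m≤m+n _ _)
  where
  lift : Varies (groupˡ m ∘ ℓ) e → Varies ℓ e
  lift (u , v , u∈ , v∈ , u≢v) = u , v , u∈ , v∈ , u≢v ∘ cong (groupˡ m)
... | no _  | yes y = ≤-trans (χ-pos (varies? _≟ˡ_ ℓ e) (lift y)) (m≤m+n _ _)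
  where
  lift : Varies (groupʳ m ∘ ℓ) e → Varies ℓ e
  lift (u , v , u∈ , v∈ , u≢v) = u , v , u∈ , v∈ , u≢v ∘ cong (groupʳ m)
... | yes x | yes y with varies-nonzero (groupˡ m ∘ ℓ) x | varies-nonzero (groupʳ m ∘ ℓ) y
...   | u , u∈e , u≢0 | v , v∈e , v≢0 =
  +-mono-≤ (χ-pos (varies? _≟ˡ_ ℓ e) (u , v , u∈e , v∈e , heavy⇒≢ h))
           (χ-pos (spreadOn? e λ u v → heavy? (ℓ u) (ℓ v)) (u , v , u∈e , v∈e , h))
  where h = groups-heavy m (ℓ u) (ℓ v) u≢0 v≢0

opt-bound : ∀ G m {opt} → IsOPT G (suc m) opt → (ℓ : Fin (∣V∣ G) → Label (m + m)) →
  (∀ i → ∃ λ v → ℓ v ≡ one i) → (∃ λ v → ℓ v ≡ many) → opt + opt ≤ total G ℓ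
opt-bound G m {opt} isOPT ℓ hit (w , ℓw≡many) = begin
  opt + opt
    ≤⟨ +-mono-≤ (lowerBound _ (parts-isPartition (groupˡ m ∘ ℓ) surjˡ))
                (lowerBound _ (parts-isPartition (groupʳ m ∘ ℓ) surjʳ)) ⟩
  cutValue G (parts (groupˡ m ∘ ℓ)) + cutValue G (parts (groupʳ m ∘ ℓ))
    ≤⟨ +-mono-≤ (cutValue-parts G _) (cutValue-parts G _) ⟩
  ∑ (E G) (χ ∘ varies? _≟_ (groupˡ m ∘ ℓ)) + ∑ (E G) (χ ∘ varies? _≟_ (groupʳ m ∘ ℓ))
    ≡⟨ ∑-+ (E G) _ _ ⟨
  ∑ (E G) _
    ≤⟨ ∑-mono (E G) (groups-weight m ℓ) ⟩
  total G ℓ ∎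
  where
  open ≤-Reasoning
  open IsOPT isOPT

  surjˡ : ∀ i → ∃ λ v → groupˡ m (ℓ v) ≡ i
  -- A vertex labelled `many` makes the rest nonempty in both partitions.
  surjˡ zero    = w , cong (groupˡ m) ℓw≡many
  surjˡ (suc i) = let v , eq = hit (i ↑ˡ m) in
    v , trans (cong (groupˡ m) eq) (cong [ suc , (λ _ → zero) ]′ (splitAt-↑ˡ m i m))

  surjʳ : ∀ i → ∃ λ v → groupʳ m (ℓ v) ≡ i
  surjʳ zero    = w , cong (groupʳ m) ℓw≡many
  surjʳ (suc i) = let v , eq = hit (m ↑ʳ i) in
    v , trans (cong (groupʳ m) eq) (cong [ (λ _ → zero) , suc ]′ (splitAt-↑ʳ m m i))

-- Minimum terminal cuts

minimiser : ∀ {n} {P : Subset n → Set} → Decidable P → (f : Subset n → ℕ) → ∃ P →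
            ∃ λ Y → P Y × (∀ Z → P Z → f Y ≤ f Z)
minimiser {P = P} P? f (Y , PY) = go Y PY (<-wellFounded (f Y))
  where
  go : ∀ Y → P Y → Acc _<_ (f Y) → ∃ λ Y → P Y × (∀ Z → P Z → f Y ≤ f Z)
  go Y PY (acc rec) with anySubset? (λ Z → P? Z ×-dec f Z <? f Y)
  ... | yes (Z , PZ , Z<Y) = go Z PZ (rec Z<Y)
  ... | no ¬smaller        = Y , PY , λ Z PZ → ≮⇒≥ λ Z<Y → ¬smaller (Z , PZ , Z<Y)

enumerate : ∀ {n} (S : Subset n) → Fin ∣ S ∣ → Fin n
enumerate (outside ∷ S) i       = suc (enumerate S i)
enumerate (inside  ∷ S) zero    = zero
enumerate (inside  ∷ S) (suc i) = suc (enumerate S i)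

enumerate-∈ : ∀ {n} (S : Subset n) i → enumerate S i ∈ S
enumerate-∈ (outside ∷ S) i       = there (enumerate-∈ S i)
enumerate-∈ (inside  ∷ S) zero    = here
enumerate-∈ (inside  ∷ S) (suc i) = there (enumerate-∈ S i)

enumerate-injective : ∀ {n} (S : Subset n) {i j} → enumerate S i ≡ enumerate S j → i ≡ j
enumerate-injective (outside ∷ S) eq = enumerate-injective S (suc-injective eq)
enumerate-injective (inside  ∷ S) {zero}  {zero}  eq = refl
enumerate-injective (inside  ∷ S) {suc i} {suc j} eq =
  cong suc (enumerate-injective S (suc-injective eq))

module _ (G : Hypergraph) (U : Subset (∣V∣ G)) where

  private
    n = ∣V∣ G

  -- When ∁ U is nonempty, these are exactly the source sets of (S, ∁ U)-terminal cuts. Nonemptiness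
  -- has to be explicit because S may be empty.
  Inner : Subset n → Subset n → Set
  Inner S Y = Nonempty Y × S ⊆ Y × Y ⊆ U

  inner? : ∀ S → Decidable (Inner S)
  inner? S Y = nonempty? Y ×-dec (S ⊆? Y ×-dec Y ⊆? U)

  Undercut : Subset n → Set
  Undercut S = ∃ λ Y → Inner S Y × d G Y < d G U

  undercut? : Decidable Undercut
  undercut? S = anySubset? λ Y → inner? S Y ×-dec d G Y <? d G U

  ¬undercut⇒sourceMaximal : Is2Partition U → ∀ S → S ⊆ U → ¬ Undercut S →
                            IsSourceMaximalMinTerminalCut G S (∁ U) U
  ¬undercut⇒sourceMaximal 2part S S⊆U ¬under = record
    { isMaximal = record
      { isMinTerminalCut = isMin
      ; maximal = λ Y Ymin U⊆Y → ⊆-antisym (inside-U (isTerminalCut Ymin)) U⊆Y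
      }
    -- A maximal Y lies inside the minimum cut `U`, so its maximality forces equality.
    ; unique = λ Y Ymax → sym (maximal Ymax U isMin (inside-U (isTerminalCut (isMinTerminalCut Ymax))))
    }
    where
    open IsTerminalCut
    open IsMinTerminalCut
    open IsMaximalMinTerminalCut

    inside-U : ∀ {Y} → IsTerminalCut S (∁ U) Y → Y ⊆ U
    inside-U Ycut {v} v∈Y = decidable-stable (v ∈? U) λ v∉U →
      x∈∁p⇒x∉p (X⊆∁T Ycut v∈Y) (x∉p⇒x∈∁p v∉U)

    isMin : IsMinTerminalCut G S (∁ U) U
    isMin = record
      { isTerminalCut = record
        { is2Partition = 2part
        ; S⊆X = S⊆U
        ; X⊆∁T = λ v∈U → x∉p⇒x∈∁p λ v∈∁U → x∈∁p⇒x∉p v∈∁U v∈U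
        }
      ; minimum = λ Y Ycut → ≮⇒≥ λ Y<U →
          ¬under (Y , (proj₁ (is2Partition Ycut) , S⊆X Ycut , inside-U Ycut) , Y<U)
      }

  -- A minimiser over the sets between S and U also beats every larger set inside U, as that set
  -- still contains S. This is the minimality used in uncrossing.
  undercut-minimum : ∀ {S} → Undercut S →
    ∃ λ X → Inner S X × d G X < d G U × (∀ Y → X ⊆ Y → Y ⊆ U → d G X ≤ d G Y)
  undercut-minimum {S} (Y , Yin , Y<U) with minimiser (inner? S) (d G) (Y , Yin)
  ... | X , Xin@((x , x∈X) , S⊆X , X⊆U) , Xmin =
    X , Xin , ≤-<-trans (Xmin Y Yin) Y<U ,
    λ Z X⊆Z Z⊆U → Xmin Z ((x , X⊆Z x∈X) , (λ s∈S → X⊆Z (S⊆X s∈S)) , Z⊆U)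

  -- Here k = m + 2, so that p = 2k - 2 is `suc m + suc m`, which is at least 2.
  critical-bound : ∀ m {opt} → IsOPT G (suc (suc m)) opt → d G U ≤ opt → Nonempty (∁ U) →
    ∀ S → ¬ Undercut S → (∀ {u} → u ∈ S → Undercut (S - u)) → ∣ S ∣ ≤ suc m + suc m
  critical-bound m {opt} isOPT U≤opt (w , w∈∁U) S ¬under crit with ∣ S ∣ ≤? suc m + suc m
  ... | yes S≤ = S≤
  ... | no ¬S≤ = ⊥-elim (<⇒≱ lt (opt-bound G (suc m) isOPT (label X) hit (w , miss)))
    where
    p≤∣S∣ : suc m + suc m ≤ ∣ S ∣
    p≤∣S∣ = <⇒≤ (≰⇒> ¬S≤)

    2≤p : 2 ≤ suc m + suc m
    2≤p = s≤s (≤-trans (s≤s z≤n) (m≤n+m (suc m) m))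

    u : Fin (suc m + suc m) → Fin n
    u i = enumerate S (inject≤ i p≤∣S∣)

    u∈S : ∀ i → u i ∈ S
    u∈S i = enumerate-∈ S _

    u-injective : ∀ {i j} → u i ≡ u j → i ≡ j
    u-injective eq = inject≤-injective p≤∣S∣ p≤∣S∣ _ _ (enumerate-injective S eq)

    cut : ∀ i → ∃ λ X → Inner (S - u i) X × d G X < d G U × (∀ Y → X ⊆ Y → Y ⊆ U → d G X ≤ d G Y)
    cut i = undercut-minimum (crit (u∈S i))

    X : Fin (suc m + suc m) → Subset n
    X i = proj₁ (cut i)

    S-u⊆X : ∀ i → S - u i ⊆ X i
    S-u⊆X i = proj₁ (proj₂ (proj₁ (proj₂ (cut i))))

    X⊆U : ∀ i → X i ⊆ U
    X⊆U i = proj₂ (proj₂ (proj₁ (proj₂ (cut i))))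

    X<U : ∀ i → d G (X i) < d G U
    X<U i = proj₁ (proj₂ (proj₂ (cut i)))

    -- Otherwise Xᵢ would contain all of S and be an undercut for S itself.
    u∉X : ∀ i → u i ∉ X i
    u∉X i u∈X = ¬under (X i , (proj₁ (proj₁ (proj₂ (cut i))) , S⊆X , X⊆U i) , X<U i)
      where
      S⊆X : S ⊆ X i
      S⊆X {v} v∈S with v ≟ u i
      ... | yes refl = u∈X
      ... | no v≢u   = S-u⊆X i (x∈p∧x≢y⇒x∈p-y v∈S v≢u)

    -- For j ≠ i, injectivity puts uᵢ in S - uⱼ, hence in Xⱼ.
    hit : ∀ i → ∃ λ v → label X v ≡ one i
    hit i = u i , label-one X i (u∉X i) λ j j≢i →
      S-u⊆X j (x∈p∧x≢y⇒x∈p-y (u∈S i) λ eq → j≢i (sym (u-injective eq)))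

    lt : total G (label X) < opt + opt
    lt = total-bound G 2≤p U X X⊆U (λ i → proj₂ (proj₂ (proj₂ (cut i)))) (λ i → <-≤-trans (X<U i) U≤opt)

    miss : label X w ≡ many
    miss = label-many 2≤p X λ i w∈X → x∈∁p⇒x∉p w∈∁U (X⊆U i w∈X)

theorem5p1 : (G : Hypergraph) (k opt : ℕ) → 2 ≤ k → IsOPT G k opt →
    (U : Subset (∣V∣ G)) → Is2Partition U → d G U ≤ opt →
    ∃ λ (S : Subset (∣V∣ G)) → S ⊆ U × ∣ S ∣ ≤ 2 * k ∸ 2 × IsSourceMaximalMinTerminalCut G S (∁ U) U
theorem5p1 G 1 opt (s≤s ())
theorem5p1 G (suc (suc m)) opt _ isOPT U 2part@(_ , ∁U≢∅) U≤opt
  with minimiser (λ S → S ⊆? U ×-dec ¬? (undercut? G U S)) ∣_∣ (U , ⊆-refl , U-not-undercut)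
  where
  -- The minimisation has a starting point, since only `U` lies between `U` and itself.
  U-not-undercut : ¬ Undercut G U U
  U-not-undercut (Y , (_ , U⊆Y , Y⊆U) , Y<U) = <-irrefl (cong (d G) (⊆-antisym Y⊆U U⊆Y)) Y<U
... | S , (S⊆U , ¬under) , S-min = S , S⊆U ,
  ≤-trans (critical-bound G U m isOPT U≤opt ∁U≢∅ S ¬under crit) (≤-reflexive size) ,
  ¬undercut⇒sourceMaximal G U 2part S S⊆U ¬under
  where
  -- Without an undercut, S - u would be a smaller candidate than S.
  crit : ∀ {u} → u ∈ S → Undercut G U (S - u)
  crit {u} u∈S = decidable-stable (undercut? G U (S - u)) λ ¬under′ →
    <⇒≱ (x∈p⇒∣p-x∣<∣p∣ u∈S) (S-min (S - u) ((λ v∈ → S⊆U (p─q⊆p S _ v∈)) , ¬under′))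

  -- The right side computes to `m + suc (suc (m + 0))`.
  size : suc m + suc m ≡ 2 * suc (suc m) ∸ 2
  size = sym (trans (cong (λ x → m + suc (suc x)) (+-identityʳ m)) (+-suc m (suc m)))
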